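{- Let $P$ be an $SP$-poset. Then for every $n\ge 0$ the coefficient of $x^n$ in $dd\mathcal{SH}(P)$, multiplied by $(-1)^n$, is the number of right deck-divider shuffles between $P$ and $\langle n\rangle$.
   Context: Posets are finite. $\langle n\rangle$ is the chain $1<2<\cdots<n$. An $SP$-poset is a poset obtained from one-point posets by finitely many applications of disjoint union and ordinal sum. The integers $d_{P,i}$ are defined by $\Omega^\circ(P,x)=\sum_{i=1}^{|P|}d_{P,i}\binom{x}{i}$, where $\Omega^\circ(P,n)$ is the number of strict order-preserving maps $P\to\langle n\rangle$. The right deck-divider shuffle series is $$dd\mathcal{SH}(P)=\sum_{i=1}^{|P|}(-1)^{|P|-i}d_{P,i}(1-x)^{i-1}.$$ A right deck-divider shuffle between $P$ and $\langle n\rangle$ is a configuration obtained by drawing the Hasse diagram of $P$ (smaller elements lower; the heights of the points may be chosen freely subject to this) and $n$ horizontal lines, in such a way that before the first line and after the last line there is at least one point of $P$, and the lines are not consecutive (between any two successive lines there is at least one point of $P$). Only the set of points of $P$ lying in each of the $n+1$ strips determined by the lines matters. Equivalently, it is a chain $\varnothing\subsetneq I_1\subsetneq I_2\subsetneq\cdots\subsetneq I_n\subsetneq P$ of lower sets of $P$, where $I_j$ is the set of points below the $j$-th line. -}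

module Defs where

open import Algebra.Properties.CommutativeMonoid.Sum as CMSum using ()
open import Data.Bool using (Bool; true; false)
open import Data.Fin using (Fin; toℕ)
import Data.Fin as Fin
import Data.Fin.Properties as Fin
open import Data.Fin.Subset using (Subset; _∈_; _⊂_; ⊤; ⊥)
open import Data.Fin.Subset.Properties using (_∈?_; _⊂?_)
open import Data.Integer using (ℤ; +_; _*_; _^_; 0ℤ; 1ℤ; -1ℤ)
import Data.Integer.Properties as ℤ
open import Data.List using (List; []; _∷_; allFin; cartesianProductWith; filter; length)
open import Data.Nat using (ℕ; zero; suc; _∸_)
open import Data.Nat.Combinatorics using (_C_)
open import Data.Product using (Σ-syntax; ∃-syntax; _×_)
open import Data.Sum.Relation.Binary.LeftOrder using (⊎-<-poset)
open import Data.Sum.Relation.Binary.Pointwise using (⊎-poset)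
import Data.Unit.Properties as Unit
open import Data.Vec using (Vec; []; _∷_; _∷ʳ_; lookup)
open import Data.Vec.Relation.Unary.All using (All; all?)
open import Data.Vec.Relation.Unary.Linked using (Linked; linked?)
open import Level using (0ℓ)
open import Relation.Binary using (Rel; IsDecPartialOrder; Poset)
import Relation.Binary.Construct.NonStrictToStrict as ToStrict
open import Relation.Binary.Morphism.Structures using (IsOrderIsomorphism)
open import Relation.Binary.PropositionalEquality using (_≡_)
open import Relation.Nullary.Decidable using (Dec; _×-dec_; _→-dec_)

open CMSum ℤ.+-0-commutativeMonoid using (sum-syntax; sum⁺-syntax)

-- Finite posets.  The order is decidable so that maps and lower sets can be
-- counted constructively; classically this is no restriction.

record FinPoset : Set₁ where
  field
    size              : ℕ
    _≼_               : Rel (Fin size) 0ℓ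
    isDecPartialOrder : IsDecPartialOrder _≡_ _≼_

  open IsDecPartialOrder isDecPartialOrder public
    using (isPartialOrder) renaming (_≤?_ to _≼?_)

  open ToStrict _≡_ _≼_ public using () renaming (_<_ to _≺_)

  _≺?_ : (x y : Fin size) → Dec (x ≺ y)
  _≺?_ = ToStrict.<-decidable _≡_ _≼_ Fin._≟_ _≼?_

  poset : Poset 0ℓ 0ℓ 0ℓ
  poset = record { isPartialOrder = isPartialOrder }

open FinPoset using (size; poset)

_≅_ : Poset 0ℓ 0ℓ 0ℓ → Poset 0ℓ 0ℓ 0ℓ → Set
P ≅ Q = Σ[ f ∈ (P.Carrier → Q.Carrier) ]
          IsOrderIsomorphism P._≈_ Q._≈_ P._≤_ Q._≤_ f
  where
  module P = Poset P
  module Q = Poset Q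

-- In ⊎-<-poset P Q every element of P lies below every element of Q.
-- Its levels d, e, f are redundant, and must be given since nothing determines
-- them.

data SPConstruction : Poset 0ℓ 0ℓ 0ℓ → Set₁ where
  point         : SPConstruction Unit.≡-poset
  disjointUnion : ∀ {P Q} → SPConstruction P → SPConstruction Q →
                  SPConstruction (⊎-poset P Q)
  ordinalSum    : ∀ {P Q} → SPConstruction P → SPConstruction Q →
                  SPConstruction (⊎-<-poset {d = 0ℓ} {e = 0ℓ} {f = 0ℓ} P Q)

IsSP : FinPoset → Set₁
IsSP P = ∃[ Q ] SPConstruction Q × poset P ≅ Q

-- All vectors of length m with entries from xs; without repetition when xs
-- has none.

vectors : {A : Set} → List A → (m : ℕ) → List (Vec A m)
vectors xs zero    = [] ∷ []
vectors xs (suc m) = cartesianProductWith _∷_ xs (vectors xs m)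

subsets : (m : ℕ) → List (Subset m)
subsets = vectors (true ∷ false ∷ [])

-- A map P → ⟨ n ⟩ is given by its vector of values; the chain ⟨ n ⟩ is Fin n.

module _ (P : FinPoset) where
  open FinPoset P using (_≼_; _≼?_; _≺_; _≺?_)

  StrictMap : {n : ℕ} → Vec (Fin n) (size P) → Set
  StrictMap f = ∀ x y → x ≺ y → lookup f x Fin.< lookup f y

  strictMap? : {n : ℕ} (f : Vec (Fin n) (size P)) → Dec (StrictMap f)
  strictMap? f = Fin.all? λ x → Fin.all? λ y →
    (x ≺? y) →-dec (lookup f x Fin.<? lookup f y)

  Ω° : ℕ → ℕ
  Ω° n = length (filter strictMap? (vectors (allFin n) (size P)))

  LowerSet : Subset (size P) → Set
  LowerSet I = ∀ x y → x ≼ y → y ∈ I → x ∈ I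

  lowerSet? : (I : Subset (size P)) → Dec (LowerSet I)
  lowerSet? I = Fin.all? λ x → Fin.all? λ y →
    (x ≼? y) →-dec ((y ∈? I) →-dec (x ∈? I))

  -- ∅ ⊊ I₁ ⊊ ⋯ ⊊ Iₙ ⊊ P.  In Data.Fin.Subset, ⊥ is the empty subset, ⊤ the
  -- full one, and _⊂_ is strict inclusion.

  DeckDividerShuffle : {n : ℕ} → Vec (Subset (size P)) n → Set
  DeckDividerShuffle Is = All LowerSet Is × Linked _⊂_ (⊥ ∷ (Is ∷ʳ ⊤))

  deckDividerShuffle? : {n : ℕ} (Is : Vec (Subset (size P)) n) →
                        Dec (DeckDividerShuffle Is)
  deckDividerShuffle? Is =
    all? lowerSet? Is ×-dec linked? _⊂?_ (⊥ ∷ (Is ∷ʳ ⊤))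

  deckDividerShuffles : ℕ → ℕ
  deckDividerShuffles n =
    length (filter deckDividerShuffle? (vectors (subsets (size P)) n))

-- The integers d i (1 ≤ i ≤ |P|) are the coefficients of Ω°(P, x) in the basis
-- of binomial polynomials.  Two polynomials agree iff they agree at all
-- naturals, so this determines those d i uniquely; the other values of d are
-- never used.  A summation index i < |P| stands for i + 1.

BinomialCoefficients : FinPoset → (ℕ → ℤ) → Set
BinomialCoefficients P d = ∀ n →
  + Ω° P n ≡ ∑[ i < size P ] (d (suc (toℕ i)) * + (n C suc (toℕ i)))

-- Formal power series in x over ℤ: the value at n is the coefficient of xⁿ.

Series : Set
Series = ℕ → ℤ

1ₛ : Series
1ₛ zero    = 1ℤ
1ₛ (suc _) = 0ℤ

1-x : Series
1-x zero          = 1ℤ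
1-x (suc zero)    = -1ℤ
1-x (suc (suc _)) = 0ℤ

_*ₛ_ : Series → Series → Series
(f *ₛ g) n = ∑[ k ≤ n ] (f (toℕ k) * g (n ∸ toℕ k))

_^ₛ_ : Series → ℕ → Series
f ^ₛ zero  = 1ₛ
f ^ₛ suc k = f *ₛ (f ^ₛ k)

-- Sum over i = 1, …, |P| of (-1)^(|P| - i) d_i (1 - x)^(i - 1).

ddSH : FinPoset → (ℕ → ℤ) → Series
ddSH P d n = ∑[ i < size P ]
  (-1ℤ ^ (size P ∸ suc (toℕ i)) * d (suc (toℕ i)) * (1-x ^ₛ toℕ i) n)

{-# OPTIONS --safe #-}

-- On functions of lower sets consider (Tf)(I) = Σ f(J) over the J ⊋ I for which
-- J ∖ I consists of minimal elements of P ∖ I, and (Hf)(I) = Σ f(J) over all lower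
-- sets J ⊋ I.  With e the indicator of J = P, cutting a strict map into its fibres
-- gives Ω°(P, n) = ((1 + T)ⁿ e)(∅), so d_i = (Tⁱ e)(∅), while the shuffles number
-- (Hⁿ⁺¹ e)(∅).  Inclusion–exclusion over the minimal elements of K ∖ I shows that
-- T, conjugated by the signs (-1)^|I|, satisfies (1 + T)(1 + H) = 1.  Hence, up to
-- signs, Hⁿ⁺¹ = (- T / (1 + T))ⁿ⁺¹ = Σ_i (-1)ⁱ (i - 1 choose n) Tⁱ.

module Submission where

open import Defs
open import Data.Integer using (ℤ; +_; _*_; _^_; -1ℤ)
open import Data.Nat using (ℕ)
open import Relation.Binary.PropositionalEquality using (_≡_)

open import Data.Bool using (Bool; true; false; if_then_else_)
import Data.Bool.Properties as Bool
open import Data.Fin using (Fin; zero; suc; toℕ)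
open import Data.Fin.Induction using (po-wellFounded)
import Data.Fin.Properties as Fin
open import Data.Fin.Subset using (Subset; _∈_; _∉_; _⊆_; _⊂_; ⊤; ⊥; ∣_∣; _∩_)
open import Data.Fin.Subset.Properties
open import Data.Integer using (0ℤ; 1ℤ; -_; _+_)
import Data.Integer.Properties as ℤ
open import Data.Integer.Tactic.RingSolver using (solve-∀)
open import Data.List using (List; []; _∷_; _++_; map; length; filter; allFin; tabulate; cartesianProductWith)
open import Data.Nat using (zero; suc; _<_; _≤_; _∸_; s≤s; z≤n)
import Data.Nat as ℕ
open import Data.Nat.Combinatorics using (_C_; nCn≡1; nCk≡nC[n∸k]; nCk+nC[k+1]≡[n+1]C[k+1]; k>n⇒nCk≡0)
open import Data.Nat.Induction using (<-rec)
import Data.Nat.Properties as ℕ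
open import Data.Product using (_×_; _,_; proj₁)
open import Data.Sum using (inj₁)
open import Data.Unit using (tt)
open import Data.Vec using (Vec; []; _∷_; _∷ʳ_; lookup)
import Data.Vec as Vec
import Data.Vec.Properties as Vec
open import Data.Vec.Relation.Unary.All using (All; all?; []; _∷_)
open import Data.Vec.Relation.Unary.Linked using (Linked; linked?; [-]; _∷_)
open import Function using (_∘_; _⇔_; mk⇔; Equivalence)
open import Induction.WellFounded using (Acc; acc)
open import Relation.Binary using (Poset; tri<; tri≈; tri>)
open import Relation.Binary.Morphism.Structures using (IsOrderIsomorphism)
open import Relation.Binary.PropositionalEquality
  using (_≢_; refl; sym; trans; cong; cong₂; subst; subst₂; module ≡-Reasoning)
open import Relation.Nullary using (Dec; yes; no; ¬_; ¬?; does; proof; Reflects; contradiction)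
open import Relation.Nullary.Decidable
  using (_×-dec_; _→-dec_; does-⇔; decidable-stable; dec-true; dec-false)
open import Relation.Nullary.Reflects using (invert)

open import Algebra.Properties.Semiring.Sum ℤ.+-*-semiring
  using (sum; sum-syntax; sum⁺-syntax; sum-cong-≗; ∑-distrib-+; *-distribˡ-sum; sum-replicate-zero)

open ≡-Reasoning

-- On the lattice of lower sets, `1 + H` is summation against the zeta function. The Möbius function
-- of this distributive lattice is (-1)^|J - I| if J - I consists of minimal elements of the
-- complement of I, and 0 otherwise: this is where T and the signs come from. Accordingly (Tⁱ e)(∅)
-- counts the strict maps of P onto ⟨i⟩. Sums run over all subsets, so H carries the indicator of
-- lower sets, whereas T reaches only lower sets by itself. The inversion is stated at lower sets,
-- hence the recurring hypothesis `LowerSet P I`. No inverse of `1 + T` is formed. The relation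
-- becomes a recursion that gives a value at I in terms of values at strictly larger sets, and
-- nilpotence turns power series into finite sums. The numbers d_i are given only through the values
-- of Ω°, so they are identified with (Tⁱ e)(∅) by independence of the binomial polynomials. Their
-- index starts at 1, so the term e(∅) has to vanish: the SP-construction supplies a point of P,
-- whence ∅ ≠ P.

private variable
  A B D : Set
  m n : ℕ

-- Indicators and sums over lists

opaque
  -- Opaque, so that an indicator stays an atom in goals and its decision procedure is not unfolded;
  -- later proofs work from the laws below.
  ⟦_⟧ : Dec A → ℤ
  ⟦ A? ⟧ = if does A? then 1ℤ else 0ℤ

  ⟦⟧-yes : (A? : Dec A) → A → ⟦ A? ⟧ ≡ 1ℤ
  ⟦⟧-yes A? a = cong (if_then 1ℤ else 0ℤ) (dec-true A? a)

  ⟦⟧-no : (A? : Dec A) → ¬ A → ⟦ A? ⟧ ≡ 0ℤ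
  ⟦⟧-no A? ¬a = cong (if_then 1ℤ else 0ℤ) (dec-false A? ¬a)

  ⟦⟧-⇔ : (A? : Dec A) (B? : Dec B) → A ⇔ B → ⟦ A? ⟧ ≡ ⟦ B? ⟧
  ⟦⟧-⇔ A? B? A⇔B = cong (if_then 1ℤ else 0ℤ) (does-⇔ A⇔B A? B?)

  ⟦⟧-× : (A? : Dec A) (B? : Dec B) → ⟦ A? ×-dec B? ⟧ ≡ ⟦ A? ⟧ * ⟦ B? ⟧
  ⟦⟧-× (yes _) (yes _) = refl
  ⟦⟧-× (yes _) (no _)  = refl
  ⟦⟧-× (no _)  B?      = refl

-- Lets a summand be rewritten under the condition that its indicator tests; inclusions and
-- lowerness enter the sums this way.
⟦⟧*-cong : (A? : Dec A) {x y : ℤ} → (A → x ≡ y) → ⟦ A? ⟧ * x ≡ ⟦ A? ⟧ * y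
⟦⟧*-cong A?@(yes a) eq = cong (⟦ A? ⟧ *_) (eq a)
⟦⟧*-cong A?@(no ¬a) {x} {y} eq = trans (cong (_* x) (⟦⟧-no A? ¬a)) (cong (_* y) (sym (⟦⟧-no A? ¬a)))

listSum : List A → (A → ℤ) → ℤ
listSum []       f = 0ℤ
listSum (x ∷ xs) f = f x + listSum xs f

infixl 10 listSum
syntax listSum xs (λ x → e) = ∑[ x ∈ xs ] e

listSum-cong : (xs : List A) {f g : A → ℤ} → (∀ x → f x ≡ g x) →
               listSum xs f ≡ listSum xs g
listSum-cong []       eq = refl
listSum-cong (x ∷ xs) eq = cong₂ _+_ (eq x) (listSum-cong xs eq)

listSum-zero : (xs : List A) → (∑[ x ∈ xs ] 0ℤ) ≡ 0ℤ
listSum-zero []       = refl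
listSum-zero (x ∷ xs) = trans (ℤ.+-identityˡ _) (listSum-zero xs)

+-interchange : ∀ a b c d → (a + b) + (c + d) ≡ (a + c) + (b + d)
+-interchange = solve-∀

listSum-+ : (xs : List A) (f g : A → ℤ) →
            (∑[ x ∈ xs ] (f x + g x)) ≡ listSum xs f + listSum xs g
listSum-+ []       f g = refl
listSum-+ (x ∷ xs) f g = trans (cong₂ _+_ {x = f x + g x} refl (listSum-+ xs f g))
                               (+-interchange (f x) (g x) _ _)

listSum-* : (xs : List A) (c : ℤ) (f : A → ℤ) →
            (∑[ x ∈ xs ] (c * f x)) ≡ c * listSum xs f
listSum-* []       c f = sym (ℤ.*-zeroʳ c)
listSum-* (x ∷ xs) c f = trans (cong₂ _+_ {x = c * f x} refl (listSum-* xs c f))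
                               (sym (ℤ.*-distribˡ-+ c (f x) _))

listSum-comm : (xs : List A) (ys : List B) (f : A → B → ℤ) →
               (∑[ x ∈ xs ] ∑[ y ∈ ys ] f x y) ≡ (∑[ y ∈ ys ] ∑[ x ∈ xs ] f x y)
listSum-comm []       ys f = sym (listSum-zero ys)
listSum-comm (x ∷ xs) ys f = trans (cong₂ _+_ {x = listSum ys (f x)} refl (listSum-comm xs ys f))
                                   (sym (listSum-+ ys (f x) _))

listSum-∑-comm : (xs : List A) (f : A → Fin n → ℤ) →
                 (∑[ x ∈ xs ] ∑[ i < n ] f x i) ≡ ∑[ i < n ] listSum xs (λ x → f x i)
listSum-∑-comm {n = n} []       f = sym (sum-replicate-zero n)
listSum-∑-comm {n = n} (x ∷ xs) f = trans (cong₂ _+_ {x = sum (f x)} refl (listSum-∑-comm xs f))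
                                  (sym (∑-distrib-+ (f x) _))

listSum-++ : (xs ys : List A) (f : A → ℤ) →
             listSum (xs ++ ys) f ≡ listSum xs f + listSum ys f
listSum-++ []       ys f = sym (ℤ.+-identityˡ _)
listSum-++ (x ∷ xs) ys f = trans (cong₂ _+_ {x = f x} refl (listSum-++ xs ys f))
                                 (sym (ℤ.+-assoc (f x) _ _))

listSum-map : (g : A → B) (xs : List A) (f : B → ℤ) →
              listSum (map g xs) f ≡ listSum xs (f ∘ g)
listSum-map g []       f = refl
listSum-map g (x ∷ xs) f = cong₂ _+_ {x = f (g x)} refl (listSum-map g xs f)

listSum-cartesianProductWith :
  (g : A → B → D) (xs : List A) (ys : List B) (f : D → ℤ) →
  listSum (cartesianProductWith g xs ys) f ≡ (∑[ x ∈ xs ] ∑[ y ∈ ys ] f (g x y))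
listSum-cartesianProductWith g []       ys f = refl
listSum-cartesianProductWith g (x ∷ xs) ys f =
  trans (listSum-++ (map (g x) ys) _ f)
        (cong₂ _+_ (listSum-map (g x) ys f) (listSum-cartesianProductWith g xs ys f))

listSum-tabulate : (g : Fin n → A) (f : A → ℤ) →
                   listSum (tabulate g) f ≡ ∑[ i < n ] f (g i)
listSum-tabulate {n = zero}  g f = refl
listSum-tabulate {n = suc _} g f = cong₂ _+_ {x = f (g zero)} refl (listSum-tabulate (g ∘ suc) f)

length-filter : {P : A → Set} (P? : ∀ x → Dec (P x)) (xs : List A) →
                + length (filter P? xs) ≡ (∑[ x ∈ xs ] ⟦ P? x ⟧)
length-filter P? []       = refl
length-filter P? (x ∷ xs) with P? x
... | yes p = cong₂ _+_ (sym (⟦⟧-yes (yes p) p)) (length-filter P? xs)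
... | no ¬p = trans (length-filter P? xs) (trans (sym (ℤ.+-identityˡ _))
                (cong (_+ (∑[ y ∈ xs ] ⟦ P? y ⟧)) (sym (⟦⟧-no (no ¬p) ¬p))))

-- Sums over all subsets

listSum-subsets : ∀ m (f : Subset (suc m) → ℤ) →
  listSum (subsets (suc m)) f ≡
  (∑[ I ∈ subsets m ] f (true ∷ I)) + (∑[ I ∈ subsets m ] f (false ∷ I))
listSum-subsets m f =
  trans (listSum-cartesianProductWith _∷_ (true ∷ false ∷ []) (subsets m) f)
        (cong₂ _+_ {x = listSum (subsets m) (f ∘ (true ∷_))} refl (ℤ.+-identityʳ _))

_≟ˢ_ : (I J : Subset m) → Dec (I ≡ J)
_≟ˢ_ = Vec.≡-dec Bool._≟_

∷-≟ˢ : ∀ s (I J : Subset m) → ⟦ (s ∷ I) ≟ˢ (s ∷ J) ⟧ ≡ ⟦ I ≟ˢ J ⟧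
∷-≟ˢ s I J = ⟦⟧-⇔ _ _ (mk⇔ Vec.∷-injectiveʳ (cong (s ∷_)))

-- Holds because `subsets m` lists every subset exactly once.
listSum-≟ˢ : (I : Subset m) (f : Subset m → ℤ) →
             (∑[ J ∈ subsets m ] (⟦ I ≟ˢ J ⟧ * f J)) ≡ f I
listSum-≟ˢ []          f = trans (ℤ.+-identityʳ _) (trans (cong (_* f []) (⟦⟧-yes ([] ≟ˢ []) refl)) (ℤ.*-identityˡ _))
listSum-≟ˢ {suc m} (true ∷ I)  f = begin
  _ ≡⟨ listSum-subsets m _ ⟩
  _ ≡⟨ cong₂ _+_ (listSum-cong (subsets m) λ J → cong (_* f (true ∷ J)) (∷-≟ˢ true I J))
                 (trans (listSum-cong (subsets m) λ J →
                          cong (_* f (false ∷ J)) (⟦⟧-no ((true ∷ I) ≟ˢ (false ∷ J)) λ ()))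
                        (listSum-zero (subsets m))) ⟩
  _ ≡⟨ ℤ.+-identityʳ _ ⟩
  _ ≡⟨ listSum-≟ˢ I (f ∘ (true ∷_)) ⟩
  _ ∎
listSum-≟ˢ {suc m} (false ∷ I) f = begin
  _ ≡⟨ listSum-subsets m _ ⟩
  _ ≡⟨ cong₂ _+_ (trans (listSum-cong (subsets m) λ J →
                          cong (_* f (true ∷ J)) (⟦⟧-no ((false ∷ I) ≟ˢ (true ∷ J)) λ ()))
                        (listSum-zero (subsets m)))
                 (listSum-cong (subsets m) λ J → cong (_* f (false ∷ J)) (∷-≟ˢ false I J)) ⟩
  _ ≡⟨ ℤ.+-identityˡ _ ⟩
  _ ≡⟨ listSum-≟ˢ I (f ∘ (false ∷_)) ⟩
  _ ∎

⟦in⊆in⟧ : (I J : Subset m) → ⟦ (true ∷ I) ⊆? (true ∷ J) ⟧ ≡ ⟦ I ⊆? J ⟧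
⟦in⊆in⟧ I J = ⟦⟧-⇔ _ _ (mk⇔ drop-∷-⊆ in⊆in)

⟦out⊆⟧ : (s : Bool) (I J : Subset m) → ⟦ (false ∷ I) ⊆? (s ∷ J) ⟧ ≡ ⟦ I ⊆? J ⟧
⟦out⊆⟧ s I J = ⟦⟧-⇔ _ _ (mk⇔ drop-∷-⊆ out⊆)

⟦in⊆out⟧ : (I J : Subset m) → ⟦ (true ∷ I) ⊆? (false ∷ J) ⟧ ≡ 0ℤ
⟦in⊆out⟧ I J = ⟦⟧-no ((true ∷ I) ⊆? (false ∷ J)) λ I⊆J → case-⊆ (I⊆J Vec.here)
  where case-⊆ : ¬ (zero ∈ (false ∷ J))
        case-⊆ ()

sgn : Subset m → ℤ
sgn I = -1ℤ ^ ∣ I ∣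

-- A point of L outside I can be added to or removed from J, which reverses the sign; the case
-- `false`, `true` performs this cancellation. If I is not contained in L, both sides are 0.
interval-sum : (I L : Subset m) →
  (∑[ J ∈ subsets m ] (⟦ I ⊆? J ⟧ * ⟦ J ⊆? L ⟧ * sgn J)) ≡ sgn I * ⟦ I ≟ˢ L ⟧
interval-sum [] [] = trans (cong₂ (λ a b → a * b * 1ℤ + 0ℤ) (⟦⟧-yes ([] ⊆? []) ⊆-refl) (⟦⟧-yes ([] ⊆? []) ⊆-refl))
                           (cong (1ℤ *_) (sym (⟦⟧-yes ([] ≟ˢ []) refl)))
interval-sum {suc m} (true ∷ I) (true ∷ L) = begin
  _ ≡⟨ listSum-subsets m _ ⟩
  _ ≡⟨ cong₂ _+_
         (trans (listSum-cong (subsets m) λ J →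
                  trans (cong₂ (λ a b → a * b * (-1ℤ * sgn J)) (⟦in⊆in⟧ I J) (⟦in⊆in⟧ J L))
                        (pull ⟦ I ⊆? J ⟧ ⟦ J ⊆? L ⟧ (sgn J)))
                (listSum-* (subsets m) -1ℤ _))
         (trans (listSum-cong (subsets m) λ J →
                  cong (λ a → a * ⟦ (false ∷ J) ⊆? (true ∷ L) ⟧ * sgn J) (⟦in⊆out⟧ I J))
                (listSum-zero (subsets m))) ⟩
  _ ≡⟨ ℤ.+-identityʳ _ ⟩
  _ ≡⟨ cong (-1ℤ *_) (interval-sum I L) ⟩
  _ ≡⟨ sym (ℤ.*-assoc -1ℤ (sgn I) _) ⟩
  _ ≡⟨ cong (-1ℤ * sgn I *_) (sym (∷-≟ˢ true I L)) ⟩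
  _ ∎
  where pull : ∀ a b c → a * b * (-1ℤ * c) ≡ -1ℤ * (a * b * c)
        pull = solve-∀
interval-sum {suc m} (true ∷ I) (false ∷ L) = begin
  _ ≡⟨ listSum-subsets m _ ⟩
  _ ≡⟨ cong₂ _+_
         (trans (listSum-cong (subsets m) λ J →
                  trans (cong (λ b → ⟦ (true ∷ I) ⊆? (true ∷ J) ⟧ * b * sgn (true ∷ J)) (⟦in⊆out⟧ J L))
                        (cong (_* sgn (true ∷ J)) (ℤ.*-zeroʳ ⟦ (true ∷ I) ⊆? (true ∷ J) ⟧)))
                (listSum-zero (subsets m)))
         (trans (listSum-cong (subsets m) λ J →
                  cong (λ a → a * ⟦ (false ∷ J) ⊆? (false ∷ L) ⟧ * sgn J) (⟦in⊆out⟧ I J))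
                (listSum-zero (subsets m))) ⟩
  _ ≡⟨ trans (sym (ℤ.*-zeroʳ (-1ℤ * sgn I))) (cong (-1ℤ * sgn I *_) (sym (⟦⟧-no ((true ∷ I) ≟ˢ (false ∷ L)) λ ()))) ⟩
  _ ∎
interval-sum {suc m} (false ∷ I) (true ∷ L) = begin
  _ ≡⟨ listSum-subsets m _ ⟩
  _ ≡⟨ sym (listSum-+ (subsets m)
         (λ J → ⟦ (false ∷ I) ⊆? (true ∷ J) ⟧ * ⟦ (true ∷ J) ⊆? (true ∷ L) ⟧ * sgn (true ∷ J))
         (λ J → ⟦ (false ∷ I) ⊆? (false ∷ J) ⟧ * ⟦ (false ∷ J) ⊆? (true ∷ L) ⟧ * sgn (false ∷ J))) ⟩
  _ ≡⟨ listSum-cong (subsets m) (λ J →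
         trans (cong₂ _+_
                 (cong₂ (λ a b → a * b * (-1ℤ * sgn J)) (⟦out⊆⟧ true I J) (⟦in⊆in⟧ J L))
                 (cong₂ (λ a b → a * b * sgn J) (⟦out⊆⟧ false I J) (⟦out⊆⟧ true J L)))
               (cancel ⟦ I ⊆? J ⟧ ⟦ J ⊆? L ⟧ (sgn J))) ⟩
  _ ≡⟨ listSum-zero (subsets m) ⟩
  _ ≡⟨ trans (sym (ℤ.*-zeroʳ (sgn I))) (cong (sgn I *_) (sym (⟦⟧-no ((false ∷ I) ≟ˢ (true ∷ L)) λ ()))) ⟩
  _ ∎
  where cancel : ∀ a b c → a * b * (-1ℤ * c) + a * b * c ≡ 0ℤ
        cancel = solve-∀
interval-sum {suc m} (false ∷ I) (false ∷ L) = begin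
  _ ≡⟨ listSum-subsets m _ ⟩
  _ ≡⟨ cong₂ _+_
         (trans (listSum-cong (subsets m) λ J →
                  trans (cong (λ b → ⟦ (false ∷ I) ⊆? (true ∷ J) ⟧ * b * sgn (true ∷ J)) (⟦in⊆out⟧ J L))
                        (cong (_* sgn (true ∷ J)) (ℤ.*-zeroʳ ⟦ (false ∷ I) ⊆? (true ∷ J) ⟧)))
                (listSum-zero (subsets m)))
         (listSum-cong (subsets m) λ J →
           cong₂ (λ a b → a * b * sgn J) (⟦out⊆⟧ false I J) (⟦out⊆⟧ false J L)) ⟩
  _ ≡⟨ ℤ.+-identityˡ _ ⟩
  _ ≡⟨ interval-sum I L ⟩
  _ ≡⟨ cong (sgn I *_) (sym (∷-≟ˢ false I L)) ⟩
  _ ∎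

⟦⊆⟧ : (I J : Subset m) → ⟦ I ⊆? J ⟧ ≡ ⟦ I ≟ˢ J ⟧ + ⟦ I ⊂? J ⟧
⟦⊆⟧ I J with I ≟ˢ J | I ⊂? J
... | yes refl     | yes I⊂J     = contradiction I⊂J (⊂-irref refl)
... | d@(yes refl) | e@(no I⊄J) = trans (⟦⟧-yes (I ⊆? J) ⊆-refl) (sym (cong₂ _+_ (⟦⟧-yes d refl) (⟦⟧-no e I⊄J)))
... | d@(no I≢J)   | e@(yes I⊂J) =
  trans (⟦⟧-yes (I ⊆? J) (p⊂q⇒p⊆q I⊂J)) (sym (cong₂ _+_ (⟦⟧-no d I≢J) (⟦⟧-yes e I⊂J)))
... | d@(no I≢J)   | e@(no I⊄J) = trans
  (⟦⟧-no (I ⊆? J) λ I⊆J → I≢J (⊆-antisym I⊆J λ {x} x∈J →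
    decidable-stable (x ∈? I) λ x∉I → I⊄J (I⊆J , x , x∈J , x∉I)))
  (sym (cong₂ _+_ (⟦⟧-no d I≢J) (⟦⟧-no e I⊄J)))

-- Splits off the diagonal term J = I, so that a sum over all J ⊇ I reads as `1 +` an operator. At a
-- lower set both step matrices have the diagonal entry 1 that is assumed of `q`.
⊆-sum : (I : Subset m) (q f : Subset m → ℤ) → q I ≡ 1ℤ →
  (∑[ J ∈ subsets m ] (⟦ I ⊆? J ⟧ * q J * f J)) ≡
  f I + (∑[ J ∈ subsets m ] (⟦ I ⊂? J ⟧ * q J * f J))
⊆-sum {m} I q f qI = begin
  _ ≡⟨ listSum-cong (subsets m) (λ J →
         trans (cong (λ z → z * q J * f J) (⟦⊆⟧ I J)) (dist ⟦ I ≟ˢ J ⟧ ⟦ I ⊂? J ⟧ (q J) (f J))) ⟩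
  _ ≡⟨ listSum-+ (subsets m) (λ J → ⟦ I ≟ˢ J ⟧ * (q J * f J)) _ ⟩
  _ ≡⟨ cong (_+ (∑[ J ∈ subsets m ] (⟦ I ⊂? J ⟧ * q J * f J)))
         (trans (listSum-≟ˢ I (λ J → q J * f J)) (trans (cong (_* f I) qI) (ℤ.*-identityˡ (f I)))) ⟩
  _ ∎
  where dist : ∀ a b c d → (a + b) * c * d ≡ a * (c * d) + b * c * d
        dist = solve-∀

∑-last : ∀ m (f : ℕ → ℤ) → ∑[ i ≤ m ] f (toℕ i) ≡ (∑[ i < m ] f (toℕ i)) + f m
∑-last zero    f = ℤ.+-comm (f 0) 0ℤ
∑-last (suc m) f = trans (cong₂ _+_ {x = f 0} refl (∑-last m (f ∘ suc)))
                         (sym (ℤ.+-assoc (f 0) (∑[ i < m ] f (suc (toℕ i))) (f (suc m))))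

shift : (ℕ → ℤ) → ℕ → ℤ
shift c zero    = 0ℤ
shift c (suc i) = c i

-- Power series in nilpotent operators on functions of subsets

module _ {m : ℕ} where
  operator : (Subset m → Subset m → ℤ) → (Subset m → ℤ) → Subset m → ℤ
  operator q f I = ∑[ J ∈ subsets m ] (⟦ I ⊂? J ⟧ * q I J * f J)

  operator-cong : ∀ q {f g} I → (∀ J → I ⊂ J → q I J * f J ≡ q I J * g J) → operator q f I ≡ operator q g I
  operator-cong q {f} {g} I eq = listSum-cong (subsets m) λ J → begin
    ⟦ I ⊂? J ⟧ * q I J * f J     ≡⟨ ℤ.*-assoc ⟦ I ⊂? J ⟧ _ _ ⟩
    ⟦ I ⊂? J ⟧ * (q I J * f J)   ≡⟨ ⟦⟧*-cong (I ⊂? J) (eq J) ⟩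
    ⟦ I ⊂? J ⟧ * (q I J * g J)   ≡⟨ ℤ.*-assoc ⟦ I ⊂? J ⟧ _ _ ⟨
    ⟦ I ⊂? J ⟧ * q I J * g J     ∎

  operator-+ : ∀ q f g I → operator q (λ J → f J + g J) I ≡ operator q f I + operator q g I
  operator-+ q f g I = trans
    (listSum-cong (subsets m) λ J → ℤ.*-distribˡ-+ (⟦ I ⊂? J ⟧ * q I J) (f J) (g J))
    (listSum-+ (subsets m) _ _)

  operator-∑ : ∀ q k (c : Fin k → ℤ) (f : Fin k → Subset m → ℤ) I →
    operator q (λ J → ∑[ i < k ] (c i * f i J)) I ≡ ∑[ i < k ] (c i * operator q (f i) I)
  operator-∑ q k c f I = begin
    (∑[ J ∈ subsets m ] (⟦ I ⊂? J ⟧ * q I J * (∑[ i < k ] (c i * f i J))))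
      ≡⟨ listSum-cong (subsets m) (λ J → trans
           (*-distribˡ-sum (⟦ I ⊂? J ⟧ * q I J) (λ i → c i * f i J))
           (sum-cong-≗ λ i → swap (⟦ I ⊂? J ⟧ * q I J) (c i) (f i J))) ⟩
    (∑[ J ∈ subsets m ] ∑[ i < k ] (c i * (⟦ I ⊂? J ⟧ * q I J * f i J)))
      ≡⟨ listSum-∑-comm {n = k} (subsets m) (λ J i → c i * (⟦ I ⊂? J ⟧ * q I J * f i J)) ⟩
    ∑[ i < k ] (listSum (subsets m) λ J → c i * (⟦ I ⊂? J ⟧ * q I J * f i J))
      ≡⟨ sum-cong-≗ (λ i → listSum-* (subsets m) (c i) _) ⟩
    ∑[ i < k ] (c i * operator q (f i) I) ∎
    where swap : ∀ a b c → a * (b * c) ≡ b * (a * c)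
          swap = solve-∀

  isFull : Subset m → ℤ
  isFull J = ⟦ ⊤ ≟ˢ J ⟧

  iterated : (Subset m → Subset m → ℤ) → ℕ → Subset m → ℤ
  iterated q zero    = isFull
  iterated q (suc k) = operator q (iterated q k)

  -- Each strict inclusion gains at least one point, so `k` steps from I need `k` points outside I.
  iterated-vanishes : ∀ q k I → m ℕ.< k ℕ.+ ∣ I ∣ → iterated q k I ≡ 0ℤ
  iterated-vanishes q zero    I p<∣I∣ = contradiction p<∣I∣ (ℕ.≤⇒≯ (∣p∣≤n I))
  iterated-vanishes q (suc k) I p<    = trans
    (operator-cong q {g = λ _ → 0ℤ} I λ J I⊂J → cong (q I J *_) (iterated-vanishes q k J
      (ℕ.<-≤-trans p< (ℕ.≤-trans (ℕ.≤-reflexive (sym (ℕ.+-suc k ∣ I ∣))) (ℕ.+-monoʳ-≤ k (p⊂q⇒∣p∣<∣q∣ I⊂J))))))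
    (trans (listSum-cong (subsets m) λ J → ℤ.*-zeroʳ (⟦ I ⊂? J ⟧ * q I J)) (listSum-zero (subsets m)))

  -- The series ∑ᵢ cᵢ Tⁱ, where T = operator q is nilpotent, applied to isFull.
  series : (Subset m → Subset m → ℤ) → (ℕ → ℤ) → Subset m → ℤ
  series q c I = ∑[ i ≤ m ] (c (toℕ i) * iterated q (toℕ i) I)

  series-cong : ∀ q {c d} I → (∀ i → c i ≡ d i) → series q c I ≡ series q d I
  series-cong q {c} {d} I eq = sum-cong-≗ {suc m} λ i → cong (_* iterated q (toℕ i) I) (eq (toℕ i))

  series-+ : ∀ q c d I → series q (λ i → c i + d i) I ≡ series q c I + series q d I
  series-+ q c d I = trans
    (sum-cong-≗ {suc m} λ i → ℤ.*-distribʳ-+ (iterated q (toℕ i) I) (c (toℕ i)) (d (toℕ i)))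
    (∑-distrib-+ {suc m} (λ i → c (toℕ i) * iterated q (toℕ i) I) (λ i → d (toℕ i) * iterated q (toℕ i) I))

  series-neg : ∀ q c I → series q (λ i → - c i) I ≡ - series q c I
  series-neg q c I = begin
    series q (λ i → - c i) I
      ≡⟨ sum-cong-≗ {suc m} (λ i → neg (c (toℕ i)) (iterated q (toℕ i) I)) ⟩
    ∑[ i ≤ m ] (-1ℤ * (c (toℕ i) * iterated q (toℕ i) I))
      ≡⟨ *-distribˡ-sum {suc m} -1ℤ (λ i → c (toℕ i) * iterated q (toℕ i) I) ⟨
    -1ℤ * series q c I
      ≡⟨ ℤ.-1*i≡-i _ ⟩
    - series q c I ∎
    where neg : ∀ a b → - a * b ≡ -1ℤ * (a * b)
          neg = solve-∀

  series-constant : ∀ q c I → (∀ i → c (suc i) ≡ 0ℤ) → series q c I ≡ c 0 * isFull I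
  series-constant q c I c≡0 = begin
    series q c I
      ≡⟨ cong₂ _+_ {x = c 0 * isFull I} refl (trans
           (sum-cong-≗ {m} λ i → cong (_* iterated q (suc (toℕ i)) I) (c≡0 (toℕ i)))
           (sum-replicate-zero m)) ⟩
    c 0 * isFull I + 0ℤ
      ≡⟨ ℤ.+-identityʳ _ ⟩
    c 0 * isFull I ∎

  -- Truncating at degree `m` is harmless: the one term pushed out of range is a multiple of
  -- `iterated q (suc m)`, which is zero by nilpotence.
  operator-series : ∀ q c I → operator q (series q c) I ≡ series q (shift c) I
  operator-series q c I = begin
    operator q (series q c) I
      ≡⟨ operator-∑ q (suc m) (c ∘ toℕ) (iterated q ∘ toℕ) I ⟩
    ∑[ i ≤ m ] (c (toℕ i) * iterated q (suc (toℕ i)) I)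
      ≡⟨ ∑-last m (λ i → c i * iterated q (suc i) I) ⟩
    (∑[ i < m ] (c (toℕ i) * iterated q (suc (toℕ i)) I)) + c m * iterated q (suc m) I
      ≡⟨ cong₂ _+_ {x = ∑[ i < m ] (c (toℕ i) * iterated q (suc (toℕ i)) I)} refl
           (trans (cong (c m *_) (iterated-vanishes q (suc m) I (s≤s (ℕ.m≤m+n m ∣ I ∣))))
                               (ℤ.*-zeroʳ (c m))) ⟩
    (∑[ i < m ] (c (toℕ i) * iterated q (suc (toℕ i)) I)) + 0ℤ
      ≡⟨ ℤ.+-comm (∑[ i < m ] (c (toℕ i) * iterated q (suc (toℕ i)) I)) 0ℤ ⟩
    series q (shift c) I ∎

-- Lower sets

module _ (P : FinPoset) where
  open FinPoset P using (size; _≺_; _≺?_; isPartialOrder)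

  -- For a lower set I this is I together with the minimal elements of its complement. Including I
  -- makes an antichain step a matter of two inclusions, I ⊆ J ⊆ `minimalAbove I`.
  minimalAbove : Subset size → Subset size
  minimalAbove I = Vec.tabulate λ x → does (Fin.all? λ z → (z ≺? x) →-dec (z ∈? I))

  ∈-minimalAbove : ∀ I x → x ∈ minimalAbove I ⇔ (∀ z → z ≺ x → z ∈ I)
  ∈-minimalAbove I x = mk⇔
    (λ x∈ → invert (subst (Reflects _) (trans (sym (Vec.lookup∘tabulate _ x)) (Vec.[]=⇒lookup x∈))
                               (proof (below? x))))
    (λ z∈ → Vec.lookup⇒[]= x _ (trans (Vec.lookup∘tabulate _ x) (dec-true (below? x) z∈)))
    where
    below? : ∀ x → Dec (∀ z → z ≺ x → z ∈ I)
    below? x = Fin.all? λ z → (z ≺? x) →-dec (z ∈? I)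

  ⊆-minimalAbove : ∀ {I} → LowerSet P I → I ⊆ minimalAbove I
  ⊆-minimalAbove {I} lower {x} x∈I =
    Equivalence.from (∈-minimalAbove I x) λ z z≺x → lower z x (proj₁ z≺x) x∈I

  -- Whatever lies strictly below a point of J is already in I.
  lower-minimalAbove : ∀ {I J} → I ⊆ J → J ⊆ minimalAbove I → LowerSet P J
  lower-minimalAbove {I} I⊆J J⊆ x y x≼y y∈J with x Fin.≟ y
  ... | yes refl = y∈J
  ... | no  x≢y  = I⊆J (Equivalence.to (∈-minimalAbove I y) (J⊆ y∈J) x (x≼y , x≢y))

  -- A minimal element of K ∖ I would lie in minimalAbove I ∩ K.
  minimalAbove∩-⊆ : ∀ {I K} → LowerSet P K → minimalAbove I ∩ K ⊆ I → K ⊆ I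
  minimalAbove∩-⊆ {I} {K} lower M∩K⊆I {x} = go x (po-wellFounded isPartialOrder x)
    where
    go : ∀ x → Acc _≺_ x → x ∈ K → x ∈ I
    go x (acc rec) x∈K = M∩K⊆I (x∈p∩q⁺ (Equivalence.from (∈-minimalAbove I x)
      (λ z z≺x → go z (rec z≺x) (lower z x (proj₁ z≺x) x∈K)) , x∈K))

  -- Tells when the interval from I to `minimalAbove I ∩ K` is a single set, which is when its
  -- alternating sum survives in the inversion.
  ≡-minimalAbove∩ : ∀ {I K} → LowerSet P I → LowerSet P K → (I ≡ minimalAbove I ∩ K) ⇔ (I ≡ K)
  ≡-minimalAbove∩ {I} {K} lowerI lowerK = mk⇔
    (λ eq → ⊆-antisym (λ {x} x∈I → p∩q⊆q (minimalAbove I) K (subst (x ∈_) eq x∈I))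
                      (minimalAbove∩-⊆ lowerK (⊆-reflexive (sym eq))))
    (λ { refl → ⊆-antisym (λ x∈I → x∈p∩q⁺ (⊆-minimalAbove lowerI x∈I , x∈I))
                          (p∩q⊆q (minimalAbove I) I) })

-- Counting maps by their zero sets

-- The sum of F over the maps {1, …, m} → {0, …, n} with zero set I.
zeroSetSum : ℕ → Subset m → (Vec ℕ m → ℤ) → ℤ
zeroSetSum n []          F = F []
zeroSetSum n (true  ∷ I) F = zeroSetSum n I (F ∘ (0 ∷_))
zeroSetSum n (false ∷ I) F = ∑[ v < n ] zeroSetSum n I (F ∘ (suc (toℕ v) ∷_))

HasZeroSet : Subset m → Vec ℕ m → Set
HasZeroSet I f = ∀ x → x ∈ I ⇔ lookup f x ≡ 0

zeroSetSum-cong : ∀ n (I : Subset m) {F G : Vec ℕ m → ℤ} →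
  (∀ f → HasZeroSet I f → F f ≡ G f) → zeroSetSum n I F ≡ zeroSetSum n I G
zeroSetSum-cong n []          eq = eq [] λ ()
zeroSetSum-cong n (true  ∷ I) eq = zeroSetSum-cong n I λ f z → eq (0 ∷ f)
  λ { zero    → mk⇔ (λ _ → refl) (λ _ → Vec.here)
    ; (suc x) → mk⇔ (Equivalence.to (z x) ∘ drop-there) (Vec.there ∘ Equivalence.from (z x)) }
zeroSetSum-cong n (false ∷ I) eq = sum-cong-≗ {n} λ v → zeroSetSum-cong n I λ f z → eq (suc (toℕ v) ∷ f)
  λ { zero    → mk⇔ (λ ()) (λ ())
    ; (suc x) → mk⇔ (Equivalence.to (z x) ∘ drop-there) (Vec.there ∘ Equivalence.from (z x)) }

zeroSetSum-* : ∀ n (I : Subset m) c (F : Vec ℕ m → ℤ) →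
  zeroSetSum n I (λ f → c * F f) ≡ c * zeroSetSum n I F
zeroSetSum-* n []          c F = refl
zeroSetSum-* n (true  ∷ I) c F = zeroSetSum-* n I c (F ∘ (0 ∷_))
zeroSetSum-* n (false ∷ I) c F = trans
  (sum-cong-≗ {n} λ v → zeroSetSum-* n I c (F ∘ (suc (toℕ v) ∷_)))
  (sym (*-distribˡ-sum {n} c λ v → zeroSetSum n I (F ∘ (suc (toℕ v) ∷_))))

-- Recovers a map with zero set I from its truncated predecessor.
raise : Subset m → Vec ℕ m → Vec ℕ m
raise = Vec.zipWith λ s v → if s then 0 else suc v

lookup-raise-∈ : ∀ {I : Subset m} {x} → x ∈ I → ∀ f → lookup (raise I f) x ≡ 0
lookup-raise-∈ Vec.here        (v ∷ f) = refl
lookup-raise-∈ (Vec.there x∈I) (v ∷ f) = lookup-raise-∈ x∈I f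

lookup-raise-∉ : ∀ {I : Subset m} {x} → x ∉ I → ∀ f → lookup (raise I f) x ≡ suc (lookup f x)
lookup-raise-∉ {I = true  ∷ I} {zero}  x∉I f       = contradiction Vec.here x∉I
lookup-raise-∉ {I = false ∷ I} {zero}  x∉I (v ∷ f) = refl
lookup-raise-∉ {I = s ∷ I}     {suc x} x∉I (v ∷ f) = lookup-raise-∉ (x∉I ∘ Vec.there) f

-- A map with zero set I is determined by the set J ⊇ I where it is at most 1
-- and by its truncated predecessor, which has zero set J.
zeroSetSum-suc : ∀ n (I : Subset m) (F : Vec ℕ m → ℤ) →
  zeroSetSum (suc n) I F ≡ (∑[ J ∈ subsets m ] (⟦ I ⊆? J ⟧ * zeroSetSum n J (F ∘ raise I)))
zeroSetSum-suc n [] F = sym (trans (ℤ.+-identityʳ _)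
  (trans (cong (_* F []) (⟦⟧-yes ([] ⊆? []) ⊆-refl)) (ℤ.*-identityˡ (F []))))
zeroSetSum-suc {suc m} n (true ∷ I) F = sym (begin
  (∑[ J ∈ subsets (suc m) ] (⟦ (true ∷ I) ⊆? J ⟧ * zeroSetSum n J (F ∘ raise (true ∷ I))))
    ≡⟨ listSum-subsets m _ ⟩
  _ ≡⟨ cong₂ _+_
         (listSum-cong (subsets m) λ J → cong (_* zeroSetSum n J (F ∘ (0 ∷_) ∘ raise I)) (⟦in⊆in⟧ I J))
         (trans (listSum-cong (subsets m) λ J →
                  cong (_* zeroSetSum n (false ∷ J) (F ∘ raise (true ∷ I))) (⟦in⊆out⟧ I J))
                (listSum-zero (subsets m))) ⟩
  _ ≡⟨ ℤ.+-identityʳ _ ⟩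
  _ ≡⟨ sym (zeroSetSum-suc n I (F ∘ (0 ∷_))) ⟩
  zeroSetSum (suc n) (true ∷ I) F ∎)
zeroSetSum-suc {suc m} n (false ∷ I) F = sym (begin
  (∑[ J ∈ subsets (suc m) ] (⟦ (false ∷ I) ⊆? J ⟧ * zeroSetSum n J (F ∘ raise (false ∷ I))))
    ≡⟨ listSum-subsets m _ ⟩
  _ ≡⟨ cong₂ _+_
         (listSum-cong (subsets m) λ J →
           cong (_* zeroSetSum n J (F ∘ (1 ∷_) ∘ raise I)) (⟦out⊆⟧ true I J))
         (trans (listSum-cong (subsets m) λ J → trans
                   (cong (_* (∑[ v < n ] G J v)) (⟦out⊆⟧ false I J))
                   (*-distribˡ-sum {n} ⟦ I ⊆? J ⟧ (G J)))
                (listSum-∑-comm {n = n} (subsets m) λ J v → ⟦ I ⊆? J ⟧ * G J v)) ⟩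
  _ ≡⟨ cong₂ _+_ (sym (zeroSetSum-suc n I (F ∘ (1 ∷_))))
                 (sum-cong-≗ {n} λ v → sym (zeroSetSum-suc n I (F ∘ (suc (suc (toℕ v)) ∷_)))) ⟩
  zeroSetSum (suc n) (false ∷ I) F ∎)
  where
  G : Subset m → Fin n → ℤ
  G J v = zeroSetSum n J (F ∘ (suc (suc (toℕ v)) ∷_) ∘ raise I)

zeroSetSum-⊤ : ∀ m (F : Vec ℕ m → ℤ) → zeroSetSum 0 ⊤ F ≡ F (Vec.replicate m 0)
zeroSetSum-⊤ zero    F = refl
zeroSetSum-⊤ (suc m) F = zeroSetSum-⊤ m (F ∘ (0 ∷_))

zeroSetSum-≢⊤ : (I : Subset m) (F : Vec ℕ m → ℤ) → ⊤ ≢ I → zeroSetSum 0 I F ≡ 0ℤ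
zeroSetSum-≢⊤ []          F ⊤≢I = contradiction refl ⊤≢I
zeroSetSum-≢⊤ (true  ∷ I) F ⊤≢I = zeroSetSum-≢⊤ I (F ∘ (0 ∷_)) (⊤≢I ∘ cong (true ∷_))
zeroSetSum-≢⊤ (false ∷ I) F ⊤≢I = refl

zeroSetSum-⊥ : ∀ m n (F : Vec ℕ m → ℤ) →
  (∑[ f ∈ vectors (allFin n) m ] F (Vec.map (suc ∘ toℕ) f)) ≡ zeroSetSum n ⊥ F
zeroSetSum-⊥ zero    n F = ℤ.+-identityʳ (F [])
zeroSetSum-⊥ (suc m) n F = begin
  (∑[ f ∈ vectors (allFin n) (suc m) ] F (Vec.map (suc ∘ toℕ) f))
    ≡⟨ listSum-cartesianProductWith _∷_ (allFin n) (vectors (allFin n) m) _ ⟩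
  (∑[ v ∈ allFin n ] ∑[ f ∈ vectors (allFin n) m ] F (suc (toℕ v) ∷ Vec.map (suc ∘ toℕ) f))
    ≡⟨ listSum-tabulate {n = n} (λ v → v) _ ⟩
  ∑[ v < n ] listSum (vectors (allFin n) m) (λ f → F (suc (toℕ v) ∷ Vec.map (suc ∘ toℕ) f))
    ≡⟨ sum-cong-≗ {n} (λ v → zeroSetSum-⊥ m n (F ∘ (suc (toℕ v) ∷_))) ⟩
  zeroSetSum n ⊥ F ∎

nC0≡1 : ∀ n → n C 0 ≡ 1
nC0≡1 n = trans (nCk≡nC[n∸k] {0} {n} z≤n) (nCn≡1 n)

-- Strict maps as powers of the antichain operator

module _ (P : FinPoset) where
  open FinPoset P using (size; _≺_; _≺?_)

  -- I is the union of the fibres already cut off. Relations with upper end in I were checked when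
  -- those fibres were cut, so only upper ends outside I are constrained.
  StrictOff : Subset size → Vec ℕ size → Set
  StrictOff I f = ∀ x y → x ≺ y → y ∉ I → lookup f x < lookup f y

  strictOff? : ∀ I f → Dec (StrictOff I f)
  strictOff? I f = Fin.all? λ x → Fin.all? λ y →
    (x ≺? y) →-dec (¬? (y ∈? I) →-dec (lookup f x ℕ.<? lookup f y))

  -- Points of J outside I get the value 1 in `raise I f`, so everything strictly below them must
  -- get 0, that is, lie in I: this is J ⊆ `minimalAbove P I`. For upper ends outside J, strictness
  -- of `raise I f` and of `f` amount to the same.
  strictOff-raise : ∀ {I J f} → LowerSet P I → I ⊆ J → HasZeroSet J f →
    StrictOff I (raise I f) ⇔ (J ⊆ minimalAbove P I × StrictOff J f)
  strictOff-raise {I} {J} {f} lower I⊆J zeros = mk⇔ split (λ { (b , s) → raised b s })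
    where
    below : StrictOff I (raise I f) → J ⊆ minimalAbove P I
    below s {y} y∈J = Equivalence.from (∈-minimalAbove P I y) z∈I
      where
      z∈I : ∀ z → z ≺ y → z ∈ I
      z∈I z z≺y with y ∈? I | z ∈? I
      ... | yes y∈I | _       = lower z y (proj₁ z≺y) y∈I
      ... | no  _   | yes z∈I = z∈I
      ... | no y∉I  | no z∉I  with ℕ.<-≤-trans (subst (_< _) (lookup-raise-∉ z∉I f) (s z y z≺y y∉I))
                                    (ℕ.≤-reflexive (trans (lookup-raise-∉ y∉I f)
                                      (cong suc (Equivalence.to (zeros y) y∈J))))
      ...   | s≤s ()

    strict : StrictOff I (raise I f) → StrictOff J f
    strict s x y x≺y y∉J with x ∈? I
    ... | yes x∈I = subst (_< lookup f y) (sym (Equivalence.to (zeros x) (I⊆J x∈I)))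
                      (ℕ.n≢0⇒n>0 (y∉J ∘ Equivalence.from (zeros y)))
    ... | no  x∉I = ℕ.s<s⁻¹ (subst₂ _<_ (lookup-raise-∉ x∉I f) (lookup-raise-∉ (y∉J ∘ I⊆J) f)
                      (s x y x≺y (y∉J ∘ I⊆J)))

    split : StrictOff I (raise I f) → J ⊆ minimalAbove P I × StrictOff J f
    split s = below s , strict s

    raised : J ⊆ minimalAbove P I → StrictOff J f → StrictOff I (raise I f)
    raised b s x y x≺y y∉I with x ∈? I
    ... | yes x∈I = subst₂ _<_ (sym (lookup-raise-∈ x∈I f)) (sym (lookup-raise-∉ y∉I f)) ℕ.z<s
    ... | no  x∉I = subst₂ _<_ (sym (lookup-raise-∉ x∉I f)) (sym (lookup-raise-∉ y∉I f))
      (ℕ.s<s (s x y x≺y λ y∈J → x∉I (Equivalence.to (∈-minimalAbove P I y) (b y∈J) x x≺y)))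

  strictCount : ℕ → Subset size → ℤ
  strictCount n I = zeroSetSum n I λ f → ⟦ strictOff? I f ⟧

  antichainStep lowerStep : Subset size → Subset size → ℤ
  antichainStep I J = ⟦ J ⊆? minimalAbove P I ⟧
  lowerStep I J = ⟦ lowerSet? P J ⟧

  -- Antichain steps lead only to lower sets, so identities known at lower sets may be applied under
  -- the operator.
  antichain-cong : ∀ {f g} I → (∀ J → LowerSet P J → I ⊂ J → f J ≡ g J) →
    operator antichainStep f I ≡ operator antichainStep g I
  antichain-cong I eq = operator-cong antichainStep I λ J I⊂J →
    ⟦⟧*-cong (J ⊆? minimalAbove P I) λ J⊆M → eq J (lower-minimalAbove P (p⊂q⇒p⊆q I⊂J) J⊆M) I⊂J

  strictCount-zero : ∀ I → strictCount 0 I ≡ isFull I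
  strictCount-zero I with ⊤ ≟ˢ I
  ... | no ⊤≢I   = trans (zeroSetSum-≢⊤ I _ ⊤≢I) (sym (⟦⟧-no (no ⊤≢I) ⊤≢I))
  ... | yes refl = begin
    strictCount 0 ⊤
      ≡⟨ zeroSetSum-⊤ size (λ f → ⟦ strictOff? ⊤ f ⟧) ⟩
    ⟦ strictOff? ⊤ (Vec.replicate size 0) ⟧
      ≡⟨ ⟦⟧-yes (strictOff? ⊤ (Vec.replicate size 0)) (λ _ _ _ y∉⊤ → contradiction ∈⊤ y∉⊤) ⟩
    1ℤ
      ≡⟨ ⟦⟧-yes (yes refl) refl ⟨
    ⟦ yes refl ⟧ ∎

  -- J is the set of points with value at most 1. The term J = I, where the value 1 is not taken, is
  -- the summand 1 in `1 + T`.
  strictCount-suc : ∀ n {I} → LowerSet P I →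
    strictCount (suc n) I ≡ strictCount n I + operator antichainStep (strictCount n) I
  strictCount-suc n {I} lower = begin
    strictCount (suc n) I
      ≡⟨ zeroSetSum-suc n I _ ⟩
    (∑[ J ∈ subsets size ] (⟦ I ⊆? J ⟧ * zeroSetSum n J (λ f → ⟦ strictOff? I (raise I f) ⟧)))
      ≡⟨ listSum-cong (subsets size) (λ J → trans
           (⟦⟧*-cong (I ⊆? J) λ I⊆J → trans
             (zeroSetSum-cong n J λ f zeros → trans
               (⟦⟧-⇔ (strictOff? I (raise I f)) ((J ⊆? minimalAbove P I) ×-dec strictOff? J f)
                     (strictOff-raise lower I⊆J zeros))
               (⟦⟧-× (J ⊆? minimalAbove P I) (strictOff? J f)))
             (zeroSetSum-* n J (antichainStep I J) (λ f → ⟦ strictOff? J f ⟧)))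
           (sym (ℤ.*-assoc ⟦ I ⊆? J ⟧ (antichainStep I J) (strictCount n J)))) ⟩
    (∑[ J ∈ subsets size ] (⟦ I ⊆? J ⟧ * antichainStep I J * strictCount n J))
      ≡⟨ ⊆-sum I (antichainStep I) (strictCount n)
           (⟦⟧-yes (I ⊆? minimalAbove P I) (⊆-minimalAbove P lower)) ⟩
    strictCount n I + operator antichainStep (strictCount n) I ∎

  -- The binomial theorem for (1 + T)ⁿ, by Pascal's rule.
  strictCount-series : ∀ n {I} → LowerSet P I →
    strictCount n I ≡ series antichainStep (λ i → + (n C i)) I
  strictCount-series zero {I} lower = begin
    strictCount 0 I
      ≡⟨ strictCount-zero I ⟩
    isFull I
      ≡⟨ ℤ.*-identityˡ (isFull I) ⟨
    1ℤ * isFull I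
      ≡⟨ series-constant antichainStep (λ i → + (0 C i)) I (λ i → cong +_ (k>n⇒nCk≡0 (ℕ.z<s {i}))) ⟨
    series antichainStep (λ i → + (0 C i)) I ∎
  strictCount-series (suc n) {I} lower = begin
    strictCount (suc n) I
      ≡⟨ strictCount-suc n lower ⟩
    strictCount n I + operator antichainStep (strictCount n) I
      ≡⟨ cong₂ _+_ (strictCount-series n lower)
           (trans (antichain-cong I λ J lowerJ _ → strictCount-series n lowerJ)
                  (operator-series antichainStep (λ i → + (n C i)) I)) ⟩
    series antichainStep (λ i → + (n C i)) I + series antichainStep (shift λ i → + (n C i)) I
      ≡⟨ series-+ antichainStep (λ i → + (n C i)) (shift λ i → + (n C i)) I ⟨
    series antichainStep (λ i → + (n C i) + shift (λ i → + (n C i)) i) I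
      ≡⟨ series-cong antichainStep I pascal ⟩
    series antichainStep (λ i → + (suc n C i)) I ∎
    where
    pascal : ∀ i → + (n C i) + shift (λ i → + (n C i)) i ≡ + (suc n C i)
    pascal zero    = trans (ℤ.+-identityʳ _) (cong +_ (trans (nC0≡1 n) (sym (nC0≡1 (suc n)))))
    pascal (suc i) = trans (ℤ.+-comm (+ (n C suc i)) (+ (n C i)))
                           (cong +_ (nCk+nC[k+1]≡[n+1]C[k+1] n i))

  Ω°-strictCount : ∀ n → + Ω° P n ≡ strictCount n ⊥
  Ω°-strictCount n = begin
    + Ω° P n
      ≡⟨ length-filter (strictMap? P) (vectors (allFin n) size) ⟩
    (∑[ f ∈ vectors (allFin n) size ] ⟦ strictMap? P f ⟧)
      ≡⟨ listSum-cong (vectors (allFin n) size) (λ f →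
           ⟦⟧-⇔ (strictMap? P f) (strictOff? ⊥ (Vec.map (suc ∘ toℕ) f)) (shifted f)) ⟩
    (∑[ f ∈ vectors (allFin n) size ] ⟦ strictOff? ⊥ (Vec.map (suc ∘ toℕ) f) ⟧)
      ≡⟨ zeroSetSum-⊥ size n (λ f → ⟦ strictOff? ⊥ f ⟧) ⟩
    strictCount n ⊥ ∎
    where
    shifted : ∀ f → StrictMap P f ⇔ StrictOff ⊥ (Vec.map (suc ∘ toℕ) f)
    shifted f = mk⇔
      (λ s x y x≺y _ → subst₂ _<_ (sym (Vec.lookup-map x (suc ∘ toℕ) f)) (sym (Vec.lookup-map y (suc ∘ toℕ) f))
                         (ℕ.s<s (s x y x≺y)))
      (λ s x y x≺y → ℕ.s<s⁻¹ (subst₂ _<_ (Vec.lookup-map x (suc ∘ toℕ) f) (Vec.lookup-map y (suc ∘ toℕ) f)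
                         (s x y x≺y ∉⊥)))

  -- Chains of lower sets

  -- The chain starts at an arbitrary I instead of `⊥`, so that its first member can be split off by
  -- induction.
  shuffleCount : ℕ → Subset size → ℤ
  shuffleCount n I = ∑[ Is ∈ vectors (subsets size) n ]
    ⟦ all? (lowerSet? P) Is ×-dec linked? _⊂?_ (I ∷ (Is ∷ʳ ⊤)) ⟧

  -- With `n` intermediate sets a chain has `n + 1` strict steps; the last one lands on `⊤`, which
  -- is a lower set too.
  shuffleCount-iterated : ∀ n I → shuffleCount n I ≡ iterated lowerStep (suc n) I
  shuffleCount-iterated zero I = begin
    shuffleCount 0 I
      ≡⟨ ℤ.+-identityʳ _ ⟩
    ⟦ all? (lowerSet? P) [] ×-dec linked? _⊂?_ (I ∷ ⊤ ∷ []) ⟧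
      ≡⟨ ⟦⟧-⇔ (all? (lowerSet? P) [] ×-dec linked? _⊂?_ (I ∷ ⊤ ∷ [])) (I ⊂? ⊤)
              (mk⇔ (λ { (_ , I⊂⊤ ∷ _) → I⊂⊤ }) λ I⊂⊤ → [] , I⊂⊤ ∷ [-]) ⟩
    ⟦ I ⊂? ⊤ ⟧
      ≡⟨ ℤ.*-identityʳ ⟦ I ⊂? ⊤ ⟧ ⟨
    ⟦ I ⊂? ⊤ ⟧ * 1ℤ
      ≡⟨ cong (⟦ I ⊂? ⊤ ⟧ *_) (⟦⟧-yes (lowerSet? P ⊤) (λ _ _ _ _ → ∈⊤)) ⟨
    ⟦ I ⊂? ⊤ ⟧ * lowerStep I ⊤
      ≡⟨ listSum-≟ˢ ⊤ (λ J → ⟦ I ⊂? J ⟧ * lowerStep I J) ⟨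
    (∑[ J ∈ subsets size ] (isFull J * (⟦ I ⊂? J ⟧ * lowerStep I J)))
      ≡⟨ listSum-cong (subsets size) (λ J → ℤ.*-comm (isFull J) (⟦ I ⊂? J ⟧ * lowerStep I J)) ⟩
    iterated lowerStep 1 I ∎
  shuffleCount-iterated (suc n) I = begin
    shuffleCount (suc n) I
      ≡⟨ listSum-cartesianProductWith _∷_ (subsets size) (vectors (subsets size) n) _ ⟩
    (∑[ J ∈ subsets size ] ∑[ Is ∈ vectors (subsets size) n ]
      ⟦ all? (lowerSet? P) (J ∷ Is) ×-dec linked? _⊂?_ (I ∷ J ∷ (Is ∷ʳ ⊤)) ⟧)
      ≡⟨ listSum-cong (subsets size) (λ J → trans
           (listSum-cong (vectors (subsets size) n) (uncons J))
           (listSum-* (vectors (subsets size) n) (⟦ I ⊂? J ⟧ * lowerStep I J) _)) ⟩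
    (∑[ J ∈ subsets size ] (⟦ I ⊂? J ⟧ * lowerStep I J * shuffleCount n J))
      ≡⟨ listSum-cong (subsets size) (λ J →
           cong (⟦ I ⊂? J ⟧ * lowerStep I J *_) (shuffleCount-iterated n J)) ⟩
    iterated lowerStep (suc (suc n)) I ∎
    where
    chain? : ∀ J (Is : Vec (Subset size) n) → Dec (All (LowerSet P) Is × Linked _⊂_ (J ∷ (Is ∷ʳ ⊤)))
    chain? J Is = all? (lowerSet? P) Is ×-dec linked? _⊂?_ (J ∷ (Is ∷ʳ ⊤))

    uncons : ∀ J (Is : Vec (Subset size) n) →
      ⟦ all? (lowerSet? P) (J ∷ Is) ×-dec linked? _⊂?_ (I ∷ J ∷ (Is ∷ʳ ⊤)) ⟧ ≡
      ⟦ I ⊂? J ⟧ * lowerStep I J * ⟦ chain? J Is ⟧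
    uncons J Is = begin
      _ ≡⟨ ⟦⟧-⇔ (all? (lowerSet? P) (J ∷ Is) ×-dec linked? _⊂?_ (I ∷ J ∷ (Is ∷ʳ ⊤)))
                ((I ⊂? J ×-dec lowerSet? P J) ×-dec chain? J Is)
                (mk⇔ (λ { (l ∷ ls , s ∷ ss) → (s , l) , ls , ss })
                     (λ { ((s , l) , ls , ss) → l ∷ ls , s ∷ ss })) ⟩
      _ ≡⟨ ⟦⟧-× (I ⊂? J ×-dec lowerSet? P J) (chain? J Is) ⟩
      _ ≡⟨ cong (_* ⟦ chain? J Is ⟧) (⟦⟧-× (I ⊂? J) (lowerSet? P J)) ⟩
      _ ∎

-- compositions n i is the number of compositions of i into n positive parts.
compositions : ℕ → ℕ → ℕ
compositions zero    zero    = 1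
compositions zero    (suc i) = 0
compositions (suc n) zero    = 0
compositions (suc n) (suc i) = i C n

-- In a composition of `i + 1` into `n + 1` parts, either the first part is 1 and is dropped, or it
-- can be lowered by 1.
compositions-suc : ∀ n i → i C n ≡ compositions n i ℕ.+ compositions (suc n) i
compositions-suc zero    zero    = refl
compositions-suc zero    (suc i) = trans (nC0≡1 (suc i)) (sym (nC0≡1 i))
compositions-suc (suc n) zero    = k>n⇒nCk≡0 (ℕ.z<s {n})
compositions-suc (suc n) (suc i) = sym (nCk+nC[k+1]≡[n+1]C[k+1] i n)

-- Chains of lower sets as a signed series in the antichain operator

module _ (P : FinPoset) where
  open FinPoset P using (size)

  private
    α = antichainStep P
    h = iterated (lowerStep P)

  chains-sum : ∀ n {J} → LowerSet P J →
    h n J + h (suc n) J ≡ (∑[ K ∈ subsets size ] (⟦ J ⊆? K ⟧ * ⟦ lowerSet? P K ⟧ * h n K))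
  chains-sum n {J} lower = sym (⊆-sum J (lowerStep P J) (h n) (⟦⟧-yes (lowerSet? P J) lower))

  -- Möbius inversion in the lattice of lower sets: the antichain steps from I,
  -- taken with signs, invert the inclusions.
  inversion : ∀ (f : Subset size → ℤ) {I} → LowerSet P I →
    (∑[ J ∈ subsets size ] (⟦ I ⊆? J ⟧ * α I J *
      (sgn J * (∑[ K ∈ subsets size ] (⟦ J ⊆? K ⟧ * ⟦ lowerSet? P K ⟧ * f K))))) ≡
    sgn I * f I
  inversion f {I} lower = begin
    (∑[ J ∈ subsets size ] (⟦ I ⊆? J ⟧ * α I J *
      (sgn J * (∑[ K ∈ subsets size ] (⟦ J ⊆? K ⟧ * ⟦ lowerSet? P K ⟧ * f K)))))
      ≡⟨ listSum-cong (subsets size) (λ J → trans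
           (sym (ℤ.*-assoc (⟦ I ⊆? J ⟧ * α I J) (sgn J) _))
           (trans (sym (listSum-* (subsets size) (⟦ I ⊆? J ⟧ * α I J * sgn J) _))
                  (listSum-cong (subsets size) λ K → trans
                    (rearrange ⟦ I ⊆? J ⟧ (α I J) (sgn J) ⟦ J ⊆? K ⟧ ⟦ lowerSet? P K ⟧ (f K))
                    (cong (λ z → ⟦ lowerSet? P K ⟧ * f K * (⟦ I ⊆? J ⟧ * z * sgn J)) (⊆-∩ J K))))) ⟩
    (∑[ J ∈ subsets size ] ∑[ K ∈ subsets size ]
      (⟦ lowerSet? P K ⟧ * f K * (⟦ I ⊆? J ⟧ * ⟦ J ⊆? minimalAbove P I ∩ K ⟧ * sgn J)))
      -- For fixed K the sets J fill a Boolean interval, so the inner sum becomes an instance of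
      -- `interval-sum`.
      ≡⟨ listSum-comm (subsets size) (subsets size) _ ⟩
    (∑[ K ∈ subsets size ] ∑[ J ∈ subsets size ]
      (⟦ lowerSet? P K ⟧ * f K * (⟦ I ⊆? J ⟧ * ⟦ J ⊆? minimalAbove P I ∩ K ⟧ * sgn J)))
      ≡⟨ listSum-cong (subsets size) (λ K → trans
           (listSum-* (subsets size) (⟦ lowerSet? P K ⟧ * f K) _)
           (cong (⟦ lowerSet? P K ⟧ * f K *_) (interval-sum I (minimalAbove P I ∩ K)))) ⟩
    (∑[ K ∈ subsets size ] (⟦ lowerSet? P K ⟧ * f K * (sgn I * ⟦ I ≟ˢ (minimalAbove P I ∩ K) ⟧)))
      ≡⟨ listSum-cong (subsets size) (λ K → trans
           (ℤ.*-assoc ⟦ lowerSet? P K ⟧ (f K) _)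
           (trans (⟦⟧*-cong (lowerSet? P K) λ lowerK → cong (λ z → f K * (sgn I * z))
                    (⟦⟧-⇔ (I ≟ˢ (minimalAbove P I ∩ K)) (I ≟ˢ K) (≡-minimalAbove∩ P lower lowerK)))
                  (reorder ⟦ lowerSet? P K ⟧ (f K) (sgn I) ⟦ I ≟ˢ K ⟧))) ⟩
    (∑[ K ∈ subsets size ] (⟦ I ≟ˢ K ⟧ * (⟦ lowerSet? P K ⟧ * (sgn I * f K))))
      ≡⟨ listSum-≟ˢ I (λ K → ⟦ lowerSet? P K ⟧ * (sgn I * f K)) ⟩
    ⟦ lowerSet? P I ⟧ * (sgn I * f I)
      ≡⟨ cong (_* (sgn I * f I)) (⟦⟧-yes (lowerSet? P I) lower) ⟩
    1ℤ * (sgn I * f I)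
      ≡⟨ ℤ.*-identityˡ (sgn I * f I) ⟩
    sgn I * f I ∎
    where
    rearrange : ∀ a b c d e g → a * b * c * (d * e * g) ≡ e * g * (a * (b * d) * c)
    rearrange = solve-∀
    reorder : ∀ a b c d → a * (b * (c * d)) ≡ d * (a * (c * b))
    reorder = solve-∀
    ⊆-∩ : ∀ J K → α I J * ⟦ J ⊆? K ⟧ ≡ ⟦ J ⊆? minimalAbove P I ∩ K ⟧
    ⊆-∩ J K = trans (sym (⟦⟧-× (J ⊆? minimalAbove P I) (J ⊆? K)))
      (⟦⟧-⇔ ((J ⊆? minimalAbove P I) ×-dec (J ⊆? K)) (J ⊆? minimalAbove P I ∩ K) (mk⇔ to from))
      where
      to : J ⊆ minimalAbove P I × J ⊆ K → J ⊆ minimalAbove P I ∩ K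
      to (J⊆M , J⊆K) x∈J = x∈p∩q⁺ (J⊆M x∈J , J⊆K x∈J)
      from : J ⊆ minimalAbove P I ∩ K → J ⊆ minimalAbove P I × J ⊆ K
      from J⊆ = (λ x∈J → p∩q⊆p (minimalAbove P I) K (J⊆ x∈J)) , (λ x∈J → p∩q⊆q (minimalAbove P I) K (J⊆ x∈J))

  -- The conjugating signs are put on the functions, so that T remains the very operator that counts
  -- strict maps.
  signedChains : ℕ → Subset size → ℤ
  signedChains n I = sgn I * h n I

  -- By `chains-sum`, `h n + h (suc n)` is `(1 + H) (h n)`. Applying `1 + T` to its signed version
  -- gives back `signedChains n`, which cancels against one summand.
  signedChains-suc : ∀ n {I} → LowerSet P I →
    signedChains (suc n) I ≡ - (operator α (signedChains n) I + operator α (signedChains (suc n)) I)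
  signedChains-suc n {I} lower = isolate (signedChains n I) (signedChains (suc n) I) _ (begin
    signedChains n I + signedChains (suc n) I + (operator α (signedChains n) I + operator α (signedChains (suc n)) I)
      ≡⟨ cong₂ _+_ (ℤ.*-distribˡ-+ (sgn I) (h n I) (h (suc n) I))
           (trans (operator-cong α I λ J _ → cong (α I J *_) (ℤ.*-distribˡ-+ (sgn J) (h n J) (h (suc n) J)))
                  (operator-+ α (signedChains n) (signedChains (suc n)) I)) ⟨
    signedSum I + operator α signedSum I
      ≡⟨ ⊆-sum I (α I) signedSum (⟦⟧-yes (I ⊆? minimalAbove P I) (⊆-minimalAbove P lower)) ⟨
    (∑[ J ∈ subsets size ] (⟦ I ⊆? J ⟧ * α I J * signedSum J))
      ≡⟨ listSum-cong (subsets size) (λ J → trans (ℤ.*-assoc ⟦ I ⊆? J ⟧ (α I J) (signedSum J)) (trans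
           (⟦⟧*-cong (I ⊆? J) λ I⊆J → ⟦⟧*-cong (J ⊆? minimalAbove P I) λ J⊆M →
             cong (sgn J *_) (chains-sum n (lower-minimalAbove P I⊆J J⊆M)))
           (sym (ℤ.*-assoc ⟦ I ⊆? J ⟧ (α I J) _)))) ⟩
    (∑[ J ∈ subsets size ] (⟦ I ⊆? J ⟧ * α I J *
      (sgn J * (∑[ K ∈ subsets size ] (⟦ J ⊆? K ⟧ * ⟦ lowerSet? P K ⟧ * h n K)))))
      ≡⟨ inversion (h n) lower ⟩
    signedChains n I ∎)
    where
    signedSum : Subset size → ℤ
    signedSum J = sgn J * (h n J + h (suc n) J)
    isolate : ∀ a b c → a + b + c ≡ a → b ≡ - c
    isolate a b c eq = begin
      b                        ≡⟨ expand a b c ⟩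
      (a + b + c) + - (a + c)  ≡⟨ cong (_+ - (a + c)) eq ⟩
      a + - (a + c)            ≡⟨ collapse a c ⟩
      - c                      ∎
      where
      expand : ∀ a b c → b ≡ (a + b + c) + - (a + c)
      expand = solve-∀
      collapse : ∀ a c → a + - (a + c) ≡ - c
      collapse = solve-∀

  -- The coefficients of (-1)^|P| (- T / (1 + T))ⁿ.
  coefficient : ℕ → ℕ → ℤ
  coefficient n i = -1ℤ ^ size * (-1ℤ ^ i * + compositions n i)

  -- With c_n = (- X / (1 + X))ⁿ this is the identity c_(n+1) = - X (c_n + c_(n+1)), compared degree
  -- by degree.
  coefficient-suc : ∀ n i →
    - (shift (coefficient n) i + shift (coefficient (suc n)) i) ≡ coefficient (suc n) i
  coefficient-suc n zero    = sym (ℤ.*-zeroʳ (-1ℤ ^ size))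
  coefficient-suc n (suc i) = begin
    - (-1ℤ ^ size * (-1ℤ ^ i * + compositions n i) + -1ℤ ^ size * (-1ℤ ^ i * + compositions (suc n) i))
      ≡⟨ factor (-1ℤ ^ size) (-1ℤ ^ i) (+ compositions n i) (+ compositions (suc n) i) ⟩
    -1ℤ ^ size * (-1ℤ ^ suc i * (+ compositions n i + + compositions (suc n) i))
      ≡⟨ cong (λ z → -1ℤ ^ size * (-1ℤ ^ suc i * z)) (cong +_ (compositions-suc n i)) ⟨
    coefficient (suc n) (suc i) ∎
    where
    factor : ∀ s t a b → - (s * (t * a) + s * (t * b)) ≡ s * (-1ℤ * t * (a + b))
    factor = solve-∀

  signedChains-series : ∀ n {I} → LowerSet P I → signedChains n I ≡ series α (coefficient n) I
  signedChains-series zero {I} lower = begin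
    sgn I * isFull I
      ≡⟨ atFull ⟩
    -1ℤ ^ size * 1ℤ * isFull I
      ≡⟨ series-constant α (coefficient 0) I
           (λ i → trans (cong (-1ℤ ^ size *_) (ℤ.*-zeroʳ (-1ℤ ^ suc i))) (ℤ.*-zeroʳ (-1ℤ ^ size))) ⟨
    series α (coefficient 0) I ∎
    where
    atFull : sgn I * isFull I ≡ -1ℤ ^ size * 1ℤ * isFull I
    atFull = begin
      sgn I * isFull I             ≡⟨ ℤ.*-comm (sgn I) (isFull I) ⟩
      -- Only I = `⊤` contributes; its sign is the factor (-1)^|P| in `coefficient`.
      isFull I * sgn I             ≡⟨ ⟦⟧*-cong (⊤ ≟ˢ I) (λ { refl → trans (cong (-1ℤ ^_) (∣⊤∣≡n size))
                                                                (sym (ℤ.*-identityʳ (-1ℤ ^ size))) }) ⟩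
      isFull I * (-1ℤ ^ size * 1ℤ) ≡⟨ ℤ.*-comm (isFull I) (-1ℤ ^ size * 1ℤ) ⟩
      -1ℤ ^ size * 1ℤ * isFull I   ∎
  signedChains-series (suc n) {I} lower = go (suc size) I lower (s≤s (ℕ.m≤m+n size ∣ I ∣))
    where
    -- The recursion refers to the same function at strictly larger sets; `k` exceeds the number of
    -- points outside I and drops at each step.
    go : ∀ k I → LowerSet P I → size < k ℕ.+ ∣ I ∣ →
         signedChains (suc n) I ≡ series α (coefficient (suc n)) I
    go zero    I lower p<∣I∣ = contradiction p<∣I∣ (ℕ.≤⇒≯ (∣p∣≤n I))
    go (suc k) I lower p<    = begin
      signedChains (suc n) I
        ≡⟨ signedChains-suc n lower ⟩
      - (operator α (signedChains n) I + operator α (signedChains (suc n)) I)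
        ≡⟨ cong -_ (cong₂ _+_
             (trans (antichain-cong P I λ J lowerJ _ → signedChains-series n lowerJ)
                    (operator-series α (coefficient n) I))
             (trans (antichain-cong P I λ J lowerJ I⊂J → go k J lowerJ (ℕ.<-≤-trans p<
                      (ℕ.≤-trans (ℕ.≤-reflexive (sym (ℕ.+-suc k ∣ I ∣))) (ℕ.+-monoʳ-≤ k (p⊂q⇒∣p∣<∣q∣ I⊂J)))))
                    (operator-series α (coefficient (suc n)) I))) ⟩
      - (series α (shift (coefficient n)) I + series α (shift (coefficient (suc n))) I)
        ≡⟨ cong -_ (series-+ α (shift (coefficient n)) (shift (coefficient (suc n))) I) ⟨
      - series α (λ i → shift (coefficient n) i + shift (coefficient (suc n)) i) I
        ≡⟨ series-neg α (λ i → shift (coefficient n) i + shift (coefficient (suc n)) i) I ⟨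
      series α (λ i → - (shift (coefficient n) i + shift (coefficient (suc n)) i)) I
        ≡⟨ series-cong α I (coefficient-suc n) ⟩
      series α (coefficient (suc n)) I ∎

-- Binomial coefficients and powers of 1 - x

∑-single : ∀ m k (f : ℕ → ℤ) → k < m → (∀ i → i ≢ k → f i ≡ 0ℤ) → ∑[ i < m ] f (toℕ i) ≡ f k
∑-single (suc m) zero    f k<m f≡0 = begin
  f 0 + ∑[ i < m ] f (suc (toℕ i))
    ≡⟨ cong₂ _+_ {x = f 0} refl (trans (sum-cong-≗ {m} λ i → f≡0 (suc (toℕ i)) λ ()) (sum-replicate-zero m)) ⟩
  f 0 + 0ℤ
    ≡⟨ ℤ.+-identityʳ (f 0) ⟩
  f 0 ∎
∑-single (suc m) (suc k) f (s≤s k<m) f≡0 = begin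
  f 0 + ∑[ i < m ] f (suc (toℕ i))
    ≡⟨ cong₂ _+_ (f≡0 0 λ ()) (∑-single m k (f ∘ suc) k<m λ i i≢k → f≡0 (suc i) (i≢k ∘ ℕ.suc-injective)) ⟩
  0ℤ + f (suc k)
    ≡⟨ ℤ.+-identityˡ (f (suc k)) ⟩
  f (suc k) ∎

-- The system is triangular: at `n = k + 1` the terms with `i > k` have binomial coefficient 0, and
-- those with `i < k` vanish by induction.
binomials-independent : ∀ m (c : ℕ → ℤ) →
  (∀ n → ∑[ i < m ] (c (toℕ i) * + (n C suc (toℕ i))) ≡ 0ℤ) → ∀ k → k < m → c k ≡ 0ℤ
binomials-independent m c eq = <-rec _ λ k rec k<m → begin
  c k
    ≡⟨ ℤ.*-identityʳ (c k) ⟨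
  c k * 1ℤ
    ≡⟨ cong (λ b → c k * + b) (nCn≡1 (suc k)) ⟨
  c k * + (suc k C suc k)
    ≡⟨ ∑-single m k (λ i → c i * + (suc k C suc i)) k<m (off k rec k<m) ⟨
  ∑[ i < m ] (c (toℕ i) * + (suc k C suc (toℕ i)))
    ≡⟨ eq (suc k) ⟩
  0ℤ ∎
  where
  off : ∀ k → (∀ {i} → i < k → i < m → c i ≡ 0ℤ) → k < m → ∀ i → i ≢ k → c i * + (suc k C suc i) ≡ 0ℤ
  off k rec k<m i i≢k with ℕ.<-cmp i k
  ... | tri< i<k _ _ = cong (_* + (suc k C suc i)) (rec i<k (ℕ.<-trans i<k k<m))
  ... | tri≈ _ i≡k _ = contradiction i≡k i≢k
  ... | tri> _ _ k<i = trans (cong (λ b → c i * + b) (k>n⇒nCk≡0 (s≤s k<i))) (ℤ.*-zeroʳ (c i))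

binomials-injective : ∀ m (c d : ℕ → ℤ) →
  (∀ n → ∑[ i < m ] (c (toℕ i) * + (n C suc (toℕ i))) ≡ ∑[ i < m ] (d (toℕ i) * + (n C suc (toℕ i)))) →
  ∀ k → k < m → c k ≡ d k
binomials-injective m c d eq k k<m =
  ℤ.i-j≡0⇒i≡j (c k) (d k) (binomials-independent m (λ i → c i + - d i) vanish k k<m)
  where
  distrib : ∀ a b x → (a + - b) * x ≡ a * x + -1ℤ * (b * x)
  distrib = solve-∀
  cancel : ∀ x → x + -1ℤ * x ≡ 0ℤ
  cancel = solve-∀
  vanish : ∀ n → ∑[ i < m ] ((c (toℕ i) + - d (toℕ i)) * + (n C suc (toℕ i))) ≡ 0ℤ
  vanish n = begin
    ∑[ i < m ] ((c (toℕ i) + - d (toℕ i)) * + (n C suc (toℕ i)))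
      ≡⟨ sum-cong-≗ {m} (λ i → distrib (c (toℕ i)) (d (toℕ i)) (+ (n C suc (toℕ i)))) ⟩
    ∑[ i < m ] (c′ i + -1ℤ * d′ i)
      ≡⟨ ∑-distrib-+ {m} c′ (λ i → -1ℤ * d′ i) ⟩
    (∑[ i < m ] c′ i) + (∑[ i < m ] (-1ℤ * d′ i))
      ≡⟨ cong₂ _+_ (eq n) (sym (*-distribˡ-sum {m} -1ℤ d′)) ⟩
    (∑[ i < m ] d′ i) + -1ℤ * (∑[ i < m ] d′ i)
      ≡⟨ cancel (∑[ i < m ] d′ i) ⟩
    0ℤ ∎
    where
    c′ d′ : Fin m → ℤ
    c′ i = c (toℕ i) * + (n C suc (toℕ i))
    d′ i = d (toℕ i) * + (n C suc (toℕ i))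

1-x-*ₛ : ∀ (g : Series) n → (1-x *ₛ g) (suc n) ≡ g (suc n) + - g n
1-x-*ₛ g n = begin
  1ℤ * g (suc n) + (-1ℤ * g n + ∑[ k < n ] (0ℤ * g (n ∸ suc (toℕ k))))
    ≡⟨ cong (λ z → 1ℤ * g (suc n) + (-1ℤ * g n + z)) (sum-replicate-zero n) ⟩
  1ℤ * g (suc n) + (-1ℤ * g n + 0ℤ)
    ≡⟨ simplify (g (suc n)) (g n) ⟩
  g (suc n) + - g n ∎
  where
  simplify : ∀ a b → 1ℤ * a + (-1ℤ * b + 0ℤ) ≡ a + - b
  simplify = solve-∀

1-x-^ₛ : ∀ k n → (1-x ^ₛ k) n ≡ -1ℤ ^ n * + (k C n)
1-x-^ₛ zero    zero    = refl
1-x-^ₛ zero    (suc n) = sym (trans (cong (λ b → -1ℤ ^ suc n * + b) (k>n⇒nCk≡0 (ℕ.z<s {n}))) (ℤ.*-zeroʳ (-1ℤ ^ suc n)))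
1-x-^ₛ (suc k) zero    = begin
  1ℤ * (1-x ^ₛ k) 0 + 0ℤ       ≡⟨ cong (λ z → 1ℤ * z + 0ℤ) (1-x-^ₛ k 0) ⟩
  1ℤ * (1ℤ * + (k C 0)) + 0ℤ   ≡⟨ cong (λ b → 1ℤ * (1ℤ * + b) + 0ℤ) (nC0≡1 k) ⟩
  1ℤ * 1ℤ                      ≡⟨ cong (λ b → 1ℤ * + b) (nC0≡1 (suc k)) ⟨
  1ℤ * + (suc k C 0)           ∎
1-x-^ₛ (suc k) (suc n) = begin
  (1-x ^ₛ suc k) (suc n)
    ≡⟨ 1-x-*ₛ (1-x ^ₛ k) n ⟩
  (1-x ^ₛ k) (suc n) + - (1-x ^ₛ k) n
    ≡⟨ cong₂ (λ a b → a + - b) (1-x-^ₛ k (suc n)) (1-x-^ₛ k n) ⟩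
  -1ℤ ^ suc n * + (k C suc n) + - (-1ℤ ^ n * + (k C n))
    ≡⟨ factor (-1ℤ ^ n) (+ (k C suc n)) (+ (k C n)) ⟩
  -1ℤ ^ suc n * (+ (k C n) + + (k C suc n))
    ≡⟨ cong (-1ℤ ^ suc n *_) (cong +_ (nCk+nC[k+1]≡[n+1]C[k+1] k n)) ⟩
  -1ℤ ^ suc n * + (suc k C suc n) ∎
  where
  factor : ∀ s a b → -1ℤ * s * a + - (s * b) ≡ -1ℤ * s * (b + a)
  factor = solve-∀

-1^n-square : ∀ n → -1ℤ ^ n * -1ℤ ^ n ≡ 1ℤ
-1^n-square zero    = refl
-1^n-square (suc n) = trans (double (-1ℤ ^ n)) (-1^n-square n)
  where
  double : ∀ s → -1ℤ * s * (-1ℤ * s) ≡ s * s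
  double = solve-∀

-1^∸ : ∀ {m n} → n ≤ m → -1ℤ ^ (m ∸ n) ≡ -1ℤ ^ m * -1ℤ ^ n
-1^∸ {m} {n} n≤m = begin
  -1ℤ ^ (m ∸ n)                         ≡⟨ ℤ.*-identityʳ (-1ℤ ^ (m ∸ n)) ⟨
  -1ℤ ^ (m ∸ n) * 1ℤ                    ≡⟨ cong (-1ℤ ^ (m ∸ n) *_) (-1^n-square n) ⟨
  -1ℤ ^ (m ∸ n) * (-1ℤ ^ n * -1ℤ ^ n)   ≡⟨ ℤ.*-assoc (-1ℤ ^ (m ∸ n)) (-1ℤ ^ n) (-1ℤ ^ n) ⟨
  -1ℤ ^ (m ∸ n) * -1ℤ ^ n * -1ℤ ^ n     ≡⟨ cong (_* -1ℤ ^ n) (ℤ.^-distribˡ-+-* -1ℤ (m ∸ n) n) ⟨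
  -1ℤ ^ (m ∸ n ℕ.+ n) * -1ℤ ^ n         ≡⟨ cong (λ k → -1ℤ ^ k * -1ℤ ^ n) (ℕ.m∸n+n≡m n≤m) ⟩
  -1ℤ ^ m * -1ℤ ^ n                     ∎

-- Evaluation at the empty lower set of a nonempty poset

SP-inhabited : ∀ {Q} → SPConstruction Q → Poset.Carrier Q
SP-inhabited point               = tt
SP-inhabited (disjointUnion p _) = inj₁ (SP-inhabited p)
SP-inhabited (ordinalSum p _)    = inj₁ (SP-inhabited p)

SP-point : ∀ P → IsSP P → Fin (FinPoset.size P)
SP-point P (Q , sp , f , iso) = proj₁ (IsOrderIsomorphism.surjective iso (SP-inhabited sp))

module _ (P : FinPoset) (x : Fin (FinPoset.size P)) where
  open FinPoset P using (size)

  private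
    a : ℕ → ℤ
    a i = iterated (antichainStep P) i ⊥

  isFull-⊥ : isFull {size} ⊥ ≡ 0ℤ
  isFull-⊥ = ⟦⟧-no (⊤ ≟ˢ ⊥) λ ⊤≡⊥ → ∉⊥ (subst (x ∈_) ⊤≡⊥ ∈⊤)

  lower-⊥ : LowerSet P ⊥
  lower-⊥ _ _ _ y∈⊥ = contradiction y∈⊥ ∉⊥

  -- The degree-zero term is a multiple of `isFull ⊥`, which is 0 because P has the point `x`. What
  -- remains starts at degree 1, as the sums over d_i do.
  series-⊥ : ∀ q c → series q c (⊥ {size}) ≡ ∑[ i < size ] (c (suc (toℕ i)) * iterated q (suc (toℕ i)) ⊥)
  series-⊥ q c = begin
    series q c ⊥                     ≡⟨ cong (λ z → c 0 * z + tail) isFull-⊥ ⟩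
    c 0 * 0ℤ + tail                  ≡⟨ cong (_+ tail) (ℤ.*-zeroʳ (c 0)) ⟩
    0ℤ + tail                        ≡⟨ ℤ.+-identityˡ tail ⟩
    tail                             ∎
    where
    tail : ℤ
    tail = ∑[ i < size ] (c (suc (toℕ i)) * iterated q (suc (toℕ i)) ⊥)

  binomialCoefficients-unique : ∀ d → BinomialCoefficients P d → ∀ i → i < size → d (suc i) ≡ a (suc i)
  binomialCoefficients-unique d bc = binomials-injective size (d ∘ suc) (a ∘ suc) λ n → begin
    ∑[ i < size ] (d (suc (toℕ i)) * + (n C suc (toℕ i)))
      ≡⟨ bc n ⟨
    + Ω° P n
      ≡⟨ Ω°-strictCount P n ⟩
    strictCount P n ⊥
      ≡⟨ strictCount-series P n lower-⊥ ⟩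
    series (antichainStep P) (λ i → + (n C i)) ⊥
      ≡⟨ series-⊥ (antichainStep P) (λ i → + (n C i)) ⟩
    ∑[ i < size ] (+ (n C suc (toℕ i)) * a (suc (toℕ i)))
      ≡⟨ sum-cong-≗ {size} (λ i → ℤ.*-comm (+ (n C suc (toℕ i))) (a (suc (toℕ i)))) ⟩
    ∑[ i < size ] (a (suc (toℕ i)) * + (n C suc (toℕ i))) ∎

  -- The sums agree term by term: up to the sign (-1)ⁿ, the coefficient of xⁿ in (1 - x)ⁱ is
  -- `i C n`, which is `compositions (suc n) (suc i)` by definition. At `⊥` the conjugating sign is
  -- 1.
  ddSH-shuffles : ∀ d → BinomialCoefficients P d → ∀ n →
    -1ℤ ^ n * ddSH P d n ≡ + deckDividerShuffles P n
  ddSH-shuffles d bc n = begin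
    -1ℤ ^ n * ddSH P d n
      ≡⟨ *-distribˡ-sum {size} (-1ℤ ^ n)
           (λ i → -1ℤ ^ (size ∸ suc (toℕ i)) * d (suc (toℕ i)) * (1-x ^ₛ toℕ i) n) ⟩
    ∑[ i < size ] (-1ℤ ^ n * (-1ℤ ^ (size ∸ suc (toℕ i)) * d (suc (toℕ i)) * (1-x ^ₛ toℕ i) n))
      ≡⟨ sum-cong-≗ {size} (λ i → term (toℕ i) (Fin.toℕ<n i)) ⟩
    ∑[ i < size ] (coefficient P (suc n) (suc (toℕ i)) * a (suc (toℕ i)))
      ≡⟨ series-⊥ (antichainStep P) (coefficient P (suc n)) ⟨
    series (antichainStep P) (coefficient P (suc n)) ⊥
      ≡⟨ signedChains-series P (suc n) lower-⊥ ⟨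
    sgn {size} ⊥ * iterated (lowerStep P) (suc n) ⊥
      ≡⟨ cong (λ k → -1ℤ ^ k * iterated (lowerStep P) (suc n) ⊥) (∣⊥∣≡0 size) ⟩
    1ℤ * iterated (lowerStep P) (suc n) ⊥
      ≡⟨ ℤ.*-identityˡ (iterated (lowerStep P) (suc n) ⊥) ⟩
    iterated (lowerStep P) (suc n) ⊥
      ≡⟨ shuffleCount-iterated P n ⊥ ⟨
    shuffleCount P n ⊥
      ≡⟨ length-filter (deckDividerShuffle? P) (vectors (subsets size) n) ⟨
    + deckDividerShuffles P n ∎
    where
    collect : ∀ s t u e b → s * (t * u * e * (s * b)) ≡ s * s * (t * (u * b) * e)
    collect = solve-∀
    term : ∀ i → i < size →
      -1ℤ ^ n * (-1ℤ ^ (size ∸ suc i) * d (suc i) * (1-x ^ₛ i) n) ≡ coefficient P (suc n) (suc i) * a (suc i)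
    term i i<p = begin
      -1ℤ ^ n * (-1ℤ ^ (size ∸ suc i) * d (suc i) * (1-x ^ₛ i) n)
        ≡⟨ cong₂ (λ u v → -1ℤ ^ n * (u * v * (1-x ^ₛ i) n)) (-1^∸ i<p) (binomialCoefficients-unique d bc i i<p) ⟩
      -1ℤ ^ n * (-1ℤ ^ size * -1ℤ ^ suc i * a (suc i) * (1-x ^ₛ i) n)
        ≡⟨ cong (λ z → -1ℤ ^ n * (-1ℤ ^ size * -1ℤ ^ suc i * a (suc i) * z)) (1-x-^ₛ i n) ⟩
      -1ℤ ^ n * (-1ℤ ^ size * -1ℤ ^ suc i * a (suc i) * (-1ℤ ^ n * + (i C n)))
        ≡⟨ collect (-1ℤ ^ n) (-1ℤ ^ size) (-1ℤ ^ suc i) (a (suc i)) (+ (i C n)) ⟩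
      -1ℤ ^ n * -1ℤ ^ n * (coefficient P (suc n) (suc i) * a (suc i))
        ≡⟨ cong (_* (coefficient P (suc n) (suc i) * a (suc i))) (-1^n-square n) ⟩
      1ℤ * (coefficient P (suc n) (suc i) * a (suc i))
        ≡⟨ ℤ.*-identityˡ (coefficient P (suc n) (suc i) * a (suc i)) ⟩
      coefficient P (suc n) (suc i) * a (suc i) ∎

theorem3p18 : (P : FinPoset) → IsSP P →
    (d : ℕ → ℤ) → BinomialCoefficients P d →
    (n : ℕ) → -1ℤ ^ n * ddSH P d n ≡ + deckDividerShuffles P n
theorem3p18 P sp = ddSH-shuffles P (SP-point P sp)
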